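{- Triangle-free fractals are exactly triangle-free graphs of class 2. That is, a simple triangle-free graph $G$ is a fractal if and only if $G$ is of class 2, i.e. $\chi'(G)=\Delta(G)+1$.
   Context: $\chi'(G)$ is the chromatic index (edge chromatic number) and $\Delta(G)$ the maximum degree; by Vizing's theorem $\chi'(G)\in\{\Delta(G),\Delta(G)+1\}$; graphs with $\chi'=\Delta$ are of class 1, those with $\chi'=\Delta+1$ are of class 2. A clique $k$-cover of $G$ is a family of cliques of $G$ such that every edge of $G$ lies in at least one of them and every vertex belongs to at most $k$ of them. The rank dimension $\dim_R(G)$ is the minimal $k$ such that $G$ has a clique $k$-cover (equivalently, $G$ is the intersection graph of the edges of a hypergraph of rank at most $k$, where the rank is the maximal size of an edge). The categorical product $G_1\times G_2$ has vertex set $V(G_1)\times V(G_2)$, with $(u_1,u_2),(v_1,v_2)$ adjacent iff $u_1v_1\in E(G_1)$ and $u_2v_2\in E(G_2)$. The Prague dimension $\dim_P(H)$ is the minimal integer $d$ such that $H$ is isomorphic to an induced subgraph of a categorical product of $d$ complete graphs. Put $\dim_L(G)=\dim_R(G)-1$ (Lebesgue dimension) and $\dim_H(G)=\dim_P(\overline{G})-1$ (Hausdorff dimension), where $\overline G$ is the complement of $G$. The graph $G$ is a fractal if $\dim_L(G)<\dim_H(G)$, i.e. $\dim_R(G)<\dim_P(\overline{G})$.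
   Formalization: The formal statement adds the hypothesis Δ(G) ≥ 2: with the given definitions every graph with a vertex and Δ(G) ≤ 1 is a fractal of class 1 (e.g. K₂ has dim_R = 1, dim_P of its complement 2, and χ' = Δ = 1), so the claim fails there. -}

module Defs where

open import Data.Nat.Base using (ℕ; _+_; _≤_)
open import Data.Integer.Base as ℤ using (ℤ; +_)
open import Data.Fin.Base using (Fin)
open import Data.Fin.Properties using (_≟_)
open import Data.Fin.Subset using (Subset; _∈_)
open import Data.Fin.Subset.Properties using (_∈?_)
open import Data.List.Base using (List; length; filter; map; allFin)
open import Data.List.Extrema.Nat using (max)
open import Data.List.Relation.Unary.All using (All)
open import Data.List.Relation.Unary.Any using (Any)
open import Data.Product.Base using (Σ-syntax; ∃-syntax; _×_; _,_)
open import Level using (0ℓ)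
open import Relation.Binary.Core using (Rel)
open import Relation.Binary.Definitions using (Symmetric; Irreflexive; Decidable)
open import Relation.Binary.Morphism.Structures using (IsOrderMonomorphism)
open import Relation.Binary.PropositionalEquality using (_≡_; _≢_; ≢-sym)
open import Relation.Nullary.Decidable using (¬?; _×-dec_)
open import Relation.Nullary.Negation using (¬_)

record Graph (n : ℕ) : Set₁ where
  field
    Adj    : Rel (Fin n) 0ℓ
    sym    : Symmetric Adj
    irrefl : Irreflexive _≡_ Adj
    Adj?   : Decidable Adj

open Graph public using (Adj; Adj?)

private
  variable
    n : ℕ

complement : Graph n → Graph n
complement G = record
  { Adj    = λ u v → u ≢ v × ¬ Adj G u v
  ; sym    = λ (u≢v , ¬uv) → ≢-sym u≢v , λ vu → ¬uv (Graph.sym G vu)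
  ; irrefl = λ u≡v (u≢v , _) → u≢v u≡v
  ; Adj?   = λ u v → ¬? (u ≟ v) ×-dec ¬? (Adj? G u v)
  }

complete : (m : ℕ) → Graph m
complete m = record
  { Adj    = _≢_
  ; sym    = ≢-sym
  ; irrefl = λ u≡v u≢v → u≢v u≡v
  ; Adj?   = λ u v → ¬? (u ≟ v)
  }

TriangleFree : Graph n → Set
TriangleFree G = ∀ {u v w} → Adj G u v → Adj G v w → ¬ Adj G u w

degree : Graph n → Fin n → ℕ
degree {n} G v = length (filter (Adj? G v) (allFin n))

Δ : Graph n → ℕ
Δ {n} G = max 0 (map (degree G) (allFin n))

IsMinimum : (ℕ → Set) → ℕ → Set
IsMinimum P k = P k × (∀ j → P j → k ≤ j)

-- A colouring of the edges is a function on proofs of adjacency; `undirected`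
-- makes it independent of both the orientation of an edge and the proof.
record EdgeColouring (G : Graph n) (k : ℕ) : Set where
  field
    colour     : ∀ {u v} → Adj G u v → Fin k
    undirected : ∀ {u v} (e : Adj G u v) (e′ : Adj G v u) → colour e ≡ colour e′
    proper     : ∀ {u v w} (e : Adj G u v) (e′ : Adj G u w) →
                 v ≢ w → colour e ≢ colour e′

IsChromaticIndex : Graph n → ℕ → Set
IsChromaticIndex G = IsMinimum (EdgeColouring G)

Class2 : Graph n → Set
Class2 G = IsChromaticIndex G (Δ G + 1)

IsClique : Graph n → Subset n → Set
IsClique G C = ∀ {u v} → u ∈ C → v ∈ C → u ≢ v → Adj G u v

record IsCliqueCover (G : Graph n) (k : ℕ) (Cs : List (Subset n)) : Set where
  field
    cliques : All (IsClique G) Cs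
    covers  : ∀ {u v} → Adj G u v → Any (λ C → u ∈ C × v ∈ C) Cs
    bounded : ∀ v → length (filter (v ∈?_) Cs) ≤ k

HasCliqueCover : Graph n → ℕ → Set
HasCliqueCover G k = ∃[ Cs ] IsCliqueCover G k Cs

IsRankDim : Graph n → ℕ → Set
IsRankDim G = IsMinimum (HasCliqueCover G)

module _ {d : ℕ} {m : Fin d → ℕ} where

  ProductVertex : Set
  ProductVertex = ∀ i → Fin (m i)

  -- Pointwise equality, since function extensionality is not available.
  _≈_ : Rel ProductVertex 0ℓ
  x ≈ y = ∀ i → x i ≡ y i

  -- Adjacency in the categorical product of the graphs F i.  It is a bare
  -- relation because the product of no graphs (d = 0) is a single looped vertex.
  ProductAdj : (∀ i → Graph (m i)) → Rel ProductVertex 0ℓ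
  ProductAdj F x y = ∀ i → Adj (F i) (x i) (y i)

-- IsOrderMonomorphism says that f is injective and both preserves and reflects
-- adjacency, i.e. is an isomorphism onto an induced subgraph; no order axioms
-- are involved.
EmbedsInCompleteProduct : Graph n → ℕ → Set
EmbedsInCompleteProduct {n} H d =
  Σ[ m ∈ (Fin d → ℕ) ] Σ[ f ∈ (Fin n → ∀ i → Fin (m i)) ]
    IsOrderMonomorphism _≡_ _≈_ (Adj H) (ProductAdj (λ i → complete (m i))) f

IsPragueDim : Graph n → ℕ → Set
IsPragueDim H = IsMinimum (EmbedsInCompleteProduct H)

IsLebesgueDim : Graph n → ℤ → Set
IsLebesgueDim G l = ∃[ r ] IsRankDim G r × l ≡ + r ℤ.- ℤ.1ℤ

IsHausdorffDim : Graph n → ℤ → Set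
IsHausdorffDim G h = ∃[ p ] IsPragueDim (complement G) p × h ≡ + p ℤ.- ℤ.1ℤ

IsFractal : Graph n → Set
IsFractal G = ∃[ l ] ∃[ h ] IsLebesgueDim G l × IsHausdorffDim G h × l ℤ.< h

{-# OPTIONS --safe #-}

-- In a triangle-free graph the cliques are the vertices and the edges.  Hence a
-- clique cover needs one clique per edge, so that the rank dimension is Δ; and the
-- fibres of the coordinates of an embedding of the complement into a product of
-- complete graphs form matchings that cover all edges, so that for Δ ≥ 2 the Prague
-- dimension is the chromatic index.  A fractal is thus a graph with χ′ > Δ, which
-- means χ′ = Δ + 1 by Vizing's theorem.
--
-- Vizing's theorem is proved by the fan argument: shift the colours along a fan at x
-- until some colour is missing at both ends of the hole, and if the colours of the
-- fan repeat first, use a Kempe chain to make the last one missing at x.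

module Submission where

open import Defs
import Algebra.Construct.NaturalChoice.Min
open import Data.Bool.Base using (true; false; if_then_else_)
open import Data.Fin.Base as Fin using (Fin; zero; suc; toℕ; fromℕ<)
open import Data.Fin.Permutation.Components using (transpose)
open import Data.Fin.Properties as Fin using (_≟_; any?; toℕ<n; toℕ-fromℕ<; pigeonhole; injective⇒≤)
open import Data.Fin.Subset using (Subset; ⁅_⁆; _∪_) renaming (_∈_ to _∈ˢ_)
open import Data.Fin.Subset.Properties using (x∈⁅x⁆; x∈⁅y⁆⇒x≡y; x∈p∪q⁺; x∈p∪q⁻) renaming (_∈?_ to _∈ˢ?_)
import Data.Integer.Base as ℤ
import Data.Integer.Properties as ℤ
open import Data.List.Base using (List; []; _∷_; length; filter; map; allFin; lookup; cartesianProduct)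
open import Data.List.Extrema.Nat using (v≤max⁺; max≤v⁺)
open import Data.List.Membership.Propositional using (_∈_; find; lose)
open import Data.List.Membership.Propositional.Properties
  using (∈-lookup; ∈-map⁺; ∈-filter⁺; ∈-filter⁻; ∈-allFin; ∈-cartesianProduct⁺)
open import Data.List.Properties using (length-tabulate)
open import Data.List.Relation.Unary.All as All using (All; []; _∷_)
import Data.List.Relation.Unary.All.Properties as All
open import Data.List.Relation.Unary.AllPairs using (_∷_)
open import Data.List.Relation.Unary.Any as Any using (Any)
import Data.List.Relation.Unary.Any.Properties as Any
open import Data.List.Relation.Unary.Unique.Propositional using (Unique)
open import Data.List.Relation.Unary.Unique.Propositional.Properties
  using (allFin⁺; filter⁺; cartesianProduct⁺)
open import Data.Nat.Base as ℕ using (ℕ; zero; suc; _≤_; _<_; s≤s; s<s; z<s; z≤n; s≤s⁻¹)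
import Data.Nat.Properties as ℕ
open import Data.Product.Base using (Σ-syntax; ∃; ∃-syntax; _×_; _,_; proj₁; proj₂)
open import Data.Sum.Base as Sum using (_⊎_; inj₁; inj₂; [_,_]′)
open import Function.Base using (_∘_; id; case_of_)
open import Function.Bundles using (_⇔_; mk⇔)
open import Relation.Binary.Definitions using (Tri; tri<; tri≈; tri>)
open import Relation.Binary.Morphism.Structures using (IsOrderMonomorphism)
open import Relation.Binary.PropositionalEquality
  using (_≡_; _≢_; refl; sym; ≢-sym; trans; cong; subst; subst₂; module ≡-Reasoning)
open import Relation.Nullary.Decidable
  using (Dec; yes; no; does; ¬?; _×-dec_; _⊎-dec_; dec-true; dec-false; map′; decidable-stable)
open import Relation.Nullary.Negation using (¬_; contradiction)
open import Relation.Unary using (Decidable)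

private
  variable
    n k : ℕ

-- Counting by injections, least witnesses, transpositions

lookup-injective : {A : Set} {xs : List A} → Unique xs →
                   ∀ i j → lookup xs i ≡ lookup xs j → i ≡ j
lookup-injective (_ ∷ _)      zero    zero    _  = refl
lookup-injective (x∉xs ∷ _)   zero    (suc j) eq = contradiction eq (All.lookup x∉xs (∈-lookup j))
lookup-injective (x∉xs ∷ _)   (suc i) zero    eq = contradiction (sym eq) (All.lookup x∉xs (∈-lookup i))
lookup-injective (_ ∷ unique) (suc i) (suc j) eq = cong suc (lookup-injective unique i j eq)

-- Each position of `xs` is sent to a position of `ys` holding a related entry. Comparing positions
-- lets `ys` have repeated entries, as a list of cliques may.
length-≤-of-injective-relation :
  {A B : Set} {R : A → B → Set} {xs : List A} {ys : List B} → Unique xs →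
  (∀ {x} → x ∈ xs → Any (R x) ys) →
  (∀ {x x′ y} → x ∈ xs → x′ ∈ xs → R x y → R x′ y → x ≡ x′) →
  length xs ≤ length ys
length-≤-of-injective-relation {R = R} {xs} {ys} unique image injective =
  injective⇒≤ {f = position} λ {i} {j} eq →
    lookup-injective unique i j
      (injective (∈-lookup i) (∈-lookup j) (related i)
        (subst (R (lookup xs j) ∘ lookup ys) (sym eq) (related j)))
  where
  position : Fin (length xs) → Fin (length ys)
  position i = Any.index (image (∈-lookup i))

  related : ∀ i → R (lookup xs i) (lookup ys (position i))
  related i = Any.lookup-index (image (∈-lookup i))

least : {P : ℕ → Set} → Decidable P → ∀ {m} → P m →
        ∃[ t ] P t × (∀ {s} → s < t → ¬ P s)
least P? {zero}  p = 0 , p , λ ()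
least P? {suc m} p with P? 0
... | yes p₀ = 0 , p₀ , λ ()
... | no ¬p₀ with t , pₜ , below ← least (P? ∘ suc) p =
  suc t , pₜ , λ { {zero} _ → ¬p₀ ; {suc s} (s≤s s<t) → below s<t }

transpose-matchˡ : (i j : Fin n) → transpose i j i ≡ j
transpose-matchˡ i j rewrite dec-true (i ≟ i) refl = refl

transpose-matchʳ : (i j : Fin n) → transpose i j j ≡ i
transpose-matchʳ i j with j ≟ i
... | yes j≡i = j≡i
... | no _ rewrite dec-true (j ≟ j) refl = refl

transpose-mismatch : (i j : Fin n) {k : Fin n} → k ≢ i → k ≢ j → transpose i j k ≡ k
transpose-mismatch i j {k} k≢i k≢j
  rewrite dec-false (k ≟ i) k≢i | dec-false (k ≟ j) k≢j = refl

transpose-involutive : (i j k : Fin n) → transpose i j (transpose i j k) ≡ k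
transpose-involutive i j k with k ≟ i
... | yes refl = transpose-matchʳ i j
... | no k≢i with k ≟ j
...   | yes refl = transpose-matchˡ i j
...   | no k≢j = transpose-mismatch i j k≢i k≢j

-- Kempe chains

-- The involutions stand for two colours, a fixed point being a vertex that misses the colour. When
-- `f` fixes `x`, the component is a path starting at `x`; the recolouring needs from this shape
-- only that there is at most one other end.
record Component (f g : Fin n → Fin n) (x : Fin n) : Set₁ where
  field
    Member   : Fin n → Set
    member?  : Decidable Member
    base     : Member x
    closedˡ  : ∀ {v} → Member v → Member (f v)
    closedʳ  : ∀ {v} → Member v → Member (g v)
    otherEnd : ∀ {p q} → Member p → Member q → p ≢ x → q ≢ x →
               f p ≡ p ⊎ g p ≡ p → f q ≡ q ⊎ g q ≡ q → p ≡ q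

module _ {f g : Fin n → Fin n}
         (f-invol : ∀ v → f (f v) ≡ v) (g-invol : ∀ v → g (g v) ≡ v)
         {x : Fin n} (fx≡x : f x ≡ x) where

  private
    φ : ℕ → Fin n → Fin n
    φ 0             = f
    φ 1             = g
    φ (suc (suc t)) = φ t

    φ-invol : ∀ t v → φ t (φ t v) ≡ v
    φ-invol 0             = f-invol
    φ-invol 1             = g-invol
    φ-invol (suc (suc t)) = φ-invol t

    φ-even : ∀ i v → φ (i ℕ.* 2) v ≡ f v
    φ-even zero    v = refl
    φ-even (suc i) v = φ-even i v

    φ-cases : ∀ t → (φ t ≡ f × φ (suc t) ≡ g) ⊎ (φ t ≡ g × φ (suc t) ≡ f)
    φ-cases 0             = inj₁ (refl , refl)
    φ-cases 1             = inj₂ (refl , refl)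
    φ-cases (suc (suc t)) = φ-cases t

    -- The first step is along `φ 1`, that is `g`, because `f` fixes `x`; then the two alternate.
    walk : ℕ → Fin n
    walk 0       = x
    walk (suc t) = φ (suc t) (walk t)

    back : ∀ t → φ (suc t) (walk (suc t)) ≡ walk t
    back t = φ-invol (suc t) (walk t)

    -- The colour of a step depends on the parity of the time only, and steps are reversible. So two
    -- equal positions at even times can be traced back together until the earlier one is at `x`.
    cancel : ∀ i j → i < j → walk (i ℕ.* 2) ≡ walk (j ℕ.* 2) →
             ∃[ m ] walk (suc m ℕ.* 2) ≡ x
    cancel zero    (suc j) _         eq = j , sym eq
    cancel (suc i) (suc j) (s≤s i<j) eq = cancel i j i<j
      (begin
        walk (i ℕ.* 2)
          ≡⟨ back (i ℕ.* 2) ⟨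
        φ (suc (i ℕ.* 2)) (walk (suc (i ℕ.* 2)))
          ≡⟨ φ-parity i j (walk (suc (i ℕ.* 2))) ⟩
        φ (suc (j ℕ.* 2)) (walk (suc (i ℕ.* 2)))
          ≡⟨ cong (φ (suc (j ℕ.* 2))) odd ⟩
        φ (suc (j ℕ.* 2)) (walk (suc (j ℕ.* 2)))
          ≡⟨ back (j ℕ.* 2) ⟩
        walk (j ℕ.* 2) ∎)
      where
      open ≡-Reasoning
      φ-odd : ∀ i v → φ (suc (i ℕ.* 2)) v ≡ g v
      φ-odd zero    v = refl
      φ-odd (suc i) v = φ-odd i v
      φ-parity : ∀ i j v → φ (suc (i ℕ.* 2)) v ≡ φ (suc (j ℕ.* 2)) v
      φ-parity i j v = trans (φ-odd i v) (sym (φ-odd j v))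
      odd : walk (suc (i ℕ.* 2)) ≡ walk (suc (j ℕ.* 2))
      odd = begin
        walk (suc (i ℕ.* 2))                  ≡⟨ back (suc (i ℕ.* 2)) ⟨
        φ (i ℕ.* 2) (walk (suc i ℕ.* 2))      ≡⟨ φ-even i _ ⟩
        f (walk (suc i ℕ.* 2))                ≡⟨ cong f eq ⟩
        f (walk (suc j ℕ.* 2))                ≡⟨ φ-even j _ ⟨
        φ (j ℕ.* 2) (walk (suc j ℕ.* 2))      ≡⟨ back (suc (j ℕ.* 2)) ⟩
        walk (suc (j ℕ.* 2))                  ∎

    Stops : ℕ → Set
    Stops t = walk (suc t) ≡ walk t

    -- A walk back at x arrived there along f, which fixes x: it had stopped.
    stops : ∃ Stops
    stops with i , j , i<j , eq ← pigeonhole (ℕ.n<1+n n) (λ i → walk (toℕ i ℕ.* 2))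
          with m , back-at-x ← cancel (toℕ i) (toℕ j) i<j eq =
      suc (m ℕ.* 2) ,
      trans back-at-x
        (trans (sym fx≡x)
          (trans (cong f (sym back-at-x))
            (trans (sym (φ-even m _)) (back (suc (m ℕ.* 2))))))

    firstStop : ∃[ t ] Stops t × (∀ {s} → s < t → ¬ Stops s)
    firstStop = least {P = Stops} (λ t → walk (suc t) ≟ walk t) {proj₁ stops} (proj₂ stops)

    end : ℕ
    end = proj₁ firstStop

    -- Cutting the walk at its first stop makes membership decidable and loses no vertex: from there
    -- on, neither colour leads anywhere new.
    Visited : Fin n → Set
    Visited v = ∃[ s ] s ≤ end × walk s ≡ v

    visited? : Decidable Visited
    visited? v = map′
      (λ (i , eq) → toℕ i , s≤s⁻¹ (toℕ<n i) , eq)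
      (λ (s , s≤end , eq) → fromℕ< (s≤s s≤end) , trans (cong walk (toℕ-fromℕ< (s≤s s≤end))) eq)
      (any? {n = suc end} (λ i → walk (toℕ i) ≟ v))

    -- At time `s` the two colours are `φ s`, by which the walk arrived, and `φ (suc s)`, by which
    -- it leaves. Following the former undoes the last step; at time 0 it is `f`, which fixes `x`.
    closed-in : ∀ {s} → s ≤ end → Visited (φ s (walk s))
    closed-in {zero}  _     = 0 , z≤n , sym fx≡x
    closed-in {suc s} s<end = s , ℕ.<⇒≤ s<end , sym (back s)

    closed-out : ∀ {s} → s ≤ end → Visited (φ (suc s) (walk s))
    closed-out {s} s≤end with ℕ.m≤n⇒m<n∨m≡n s≤end
    ... | inj₁ s<end = suc s , s<end , refl
    ... | inj₂ refl  = end , ℕ.≤-refl , sym (proj₁ (proj₂ firstStop))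

    closed-f : ∀ {v} → Visited v → Visited (f v)
    closed-f (s , s≤end , refl) with φ-cases s
    ... | inj₁ (p , _) = subst (λ h → Visited (h (walk s))) p (closed-in s≤end)
    ... | inj₂ (_ , p) = subst (λ h → Visited (h (walk s))) p (closed-out s≤end)

    closed-g : ∀ {v} → Visited v → Visited (g v)
    closed-g (s , s≤end , refl) with φ-cases s
    ... | inj₁ (_ , p) = subst (λ h → Visited (h (walk s))) p (closed-out s≤end)
    ... | inj₂ (p , _) = subst (λ h → Visited (h (walk s))) p (closed-in s≤end)

    -- Otherwise the walk would have stopped one step before reaching this vertex, hence before
    -- `end`.
    end-in : ∀ {s} → s ≤ end → walk s ≢ x → φ s (walk s) ≢ walk s
    end-in {zero}  _     ≢x _  = ≢x refl
    end-in {suc s} s<end _  eq =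
      proj₂ (proj₂ firstStop) s<end (trans (sym eq) (back s))

    end-out : ∀ {s} → s ≤ end → φ (suc s) (walk s) ≡ walk s → s ≡ end
    end-out s≤end eq with ℕ.m≤n⇒m<n∨m≡n s≤end
    ... | inj₁ s<end = contradiction eq (proj₂ (proj₂ firstStop) s<end)
    ... | inj₂ s≡end = s≡end

    -- Away from `x` the colour of arrival moves the vertex, so the fixing colour is that of
    -- departure, and the walk stops here.
    at-end : ∀ {v} → Visited v → v ≢ x → f v ≡ v ⊎ g v ≡ v → v ≡ walk end
    at-end (s , s≤end , refl) ≢x fixed =
      cong walk (end-out s≤end (out (φ-cases s) fixed))
      where
      out : (φ s ≡ f × φ (suc s) ≡ g) ⊎ (φ s ≡ g × φ (suc s) ≡ f) →
            f (walk s) ≡ walk s ⊎ g (walk s) ≡ walk s → φ (suc s) (walk s) ≡ walk s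
      out (inj₁ (p , _)) (inj₁ eq) = contradiction (trans (cong (λ h → h (walk s)) p) eq) (end-in s≤end ≢x)
      out (inj₁ (_ , p)) (inj₂ eq) = trans (cong (λ h → h (walk s)) p) eq
      out (inj₂ (_ , p)) (inj₁ eq) = trans (cong (λ h → h (walk s)) p) eq
      out (inj₂ (p , _)) (inj₂ eq) = contradiction (trans (cong (λ h → h (walk s)) p) eq) (end-in s≤end ≢x)

  component : Component f g x
  component = record
    { Member   = Visited
    ; member?  = visited?
    ; base     = 0 , z≤n , refl
    ; closedˡ  = closed-f
    ; closedʳ  = closed-g
    ; otherEnd = λ p∈ q∈ p≢x q≢x fix-p fix-q →
        trans (at-end p∈ p≢x fix-p) (sym (at-end q∈ q≢x fix-q))
    }

-- Vizing's theorem

-- mate d v is the other end of the edge of colour d at v, or v if there is none.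
record PartialColouring (G : Graph n) (k : ℕ) : Set where
  field
    mate       : Fin k → Fin n → Fin n
    involutive : ∀ d v → mate d (mate d v) ≡ v
    adjacent   : ∀ d v → mate d v ≢ v → Adj G v (mate d v)
    disjoint   : ∀ {d e v} → mate d v ≡ mate e v → mate d v ≢ v → d ≡ e

open PartialColouring

module _ {G : Graph n} where

  Covered : PartialColouring G k → Fin n → Fin n → Set
  Covered C u v = ∃[ d ] mate C d u ≡ v

  covered-sym : ∀ (C : PartialColouring G k) {u v} → Covered C u v → Covered C v u
  covered-sym C (d , refl) = d , involutive C d _

  Adj⇒≢ : ∀ {u v} → Adj G u v → u ≢ v
  Adj⇒≢ uv u≡v = Graph.irrefl G u≡v uv

  -- Adjacency is demanded because a vertex that misses a colour is `Covered` with itself.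
  Extends : (C C′ : PartialColouring G k) → Set
  Extends C C′ = ∀ {u v} → Adj G u v → Covered C u v → Covered C′ u v

  CanColour : PartialColouring G k → Fin n → Fin n → Set
  CanColour {k} C x y = Σ[ C′ ∈ PartialColouring G k ] Extends C C′ × Covered C′ x y

  -- The common form of moving a colour along a fan and of a Kempe swap: the mates are replaced on a
  -- set of pairs of a colour and a vertex that is closed under both old and new mates. A conflict
  -- at a vertex is then between two new mates or between a new and an old one.
  module Modify (C : PartialColouring G k)
    {Q : Fin k → Fin n → Set} (Q? : ∀ d v → Dec (Q d v)) (g : Fin k → Fin n → Fin n)
    where

    newMate : Fin k → Fin n → Fin n
    newMate d v = if does (Q? d v) then g d v else mate C d v

    inside : ∀ {d v} → Q d v → newMate d v ≡ g d v
    inside {d} {v} q rewrite dec-true (Q? d v) q = refl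

    outside : ∀ {d v} → ¬ Q d v → newMate d v ≡ mate C d v
    outside {d} {v} ¬q rewrite dec-false (Q? d v) ¬q = refl

    module _
      (closed-mate : ∀ {d v} → Q d v → Q d (mate C d v))
      (closed-g    : ∀ {d v} → Q d v → Q d (g d v))
      (invol-g     : ∀ {d v} → Q d v → g d (g d v) ≡ v)
      (adj-g       : ∀ {d v} → Q d v → g d v ≢ v → Adj G v (g d v))
      (disjoint-g  : ∀ {d e v} → Q d v → Q e v → g d v ≡ g e v → g d v ≢ v → d ≡ e)
      (disjoint-mix : ∀ {d e v} → Q d v → ¬ Q e v → g d v ≡ mate C e v → g d v ≢ v → d ≡ e)
      where

      modified : PartialColouring G k
      modified .mate = newMate
      modified .involutive d v with Q? d v
      ... | yes q = trans (inside (closed-g q)) (invol-g q)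
      ... | no ¬q = trans
        -- If the mate of `v` were in the set, so would be its own mate, which is `v`.
        (outside (λ q → ¬q (subst (Q d) (involutive C d v) (closed-mate q))))
        (involutive C d v)
      modified .adjacent d v ≢v with Q? d v
      ... | yes q = adj-g q ≢v
      ... | no _  = adjacent C d v ≢v
      modified .disjoint {d} {e} {v} eq ≢v with Q? d v | Q? e v
      ... | yes p | yes q = disjoint-g p q eq ≢v
      ... | yes p | no ¬q = disjoint-mix p ¬q eq ≢v
      ... | no ¬p | yes q = sym (disjoint-mix q ¬p (sym eq) (≢v ∘ trans eq))
      ... | no _  | no _  = disjoint C eq ≢v

  -- If z ≡ x, no edge loses its colour: the same move that shifts a fan also completes it.
  module Move (C : PartialColouring G k) (a : Fin k) {x y : Fin n} (xy : Adj G x y)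
    (y-misses-a : mate C a y ≡ y) (uncovered : ¬ Covered C x y)
    where

    private
      z : Fin n
      z = mate C a x

      -- The old mate `z` is included so that the transposition of `x` and `y` fixes it, which takes
      -- the colour `a` away from `z` unless `z ≡ x`.
      Q : Fin k → Fin n → Set
      Q d v = d ≡ a × (v ≡ x ⊎ v ≡ y ⊎ v ≡ z)

      z≢y : z ≢ y
      z≢y z≡y = uncovered (a , z≡y)

      closed-transpose : ∀ {v} → v ≡ x ⊎ v ≡ y ⊎ v ≡ z →
        transpose x y v ≡ x ⊎ transpose x y v ≡ y ⊎ transpose x y v ≡ z
      closed-transpose (inj₁ refl)        = inj₂ (inj₁ (transpose-matchˡ x y))
      closed-transpose (inj₂ (inj₁ refl)) = inj₁ (transpose-matchʳ x y)
      closed-transpose (inj₂ (inj₂ refl)) = case z ≟ x of λ where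
        (yes z≡x) → inj₂ (inj₁ (trans (cong (transpose x y) z≡x) (transpose-matchˡ x y)))
        (no z≢x)  → inj₂ (inj₂ (transpose-mismatch x y z≢x z≢y))

      transpose-moves : ∀ {v} → transpose x y v ≢ v →
                        (v ≡ x × transpose x y v ≡ y) ⊎ (v ≡ y × transpose x y v ≡ x)
      transpose-moves {v} ≢v with v ≟ x
      ... | yes refl = inj₁ (refl , refl)
      ... | no v≢x with v ≟ y
      ...   | yes refl = inj₂ (refl , refl)
      ...   | no v≢y = contradiction refl ≢v

      open Modify C {Q} (λ d v → d ≟ a ×-dec (v ≟ x ⊎-dec v ≟ y ⊎-dec v ≟ z))
                    (λ _ → transpose x y)

      closed-mate : ∀ {d v} → Q d v → Q d (mate C d v)
      closed-mate (refl , inj₁ refl)        = refl , inj₂ (inj₂ refl)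
      closed-mate (refl , inj₂ (inj₁ refl)) = refl , inj₂ (inj₁ y-misses-a)
      closed-mate (refl , inj₂ (inj₂ refl)) = refl , inj₁ (involutive C a x)

      adj-transpose : ∀ {v} → transpose x y v ≢ v → Adj G v (transpose x y v)
      adj-transpose ≢v with transpose-moves ≢v
      ... | inj₁ (refl , eq) = subst (Adj G x) (sym eq) xy
      ... | inj₂ (refl , eq) = subst (Adj G y) (sym eq) (Graph.sym G xy)

      not-mate : ∀ {e v} → transpose x y v ≢ v → transpose x y v ≢ mate C e v
      not-mate {e} ≢v eq with transpose-moves ≢v
      ... | inj₁ (refl , to-y) = uncovered (e , trans (sym eq) to-y)
      ... | inj₂ (refl , to-x) = uncovered (covered-sym C (e , trans (sym eq) to-x))

    moved : PartialColouring G k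
    moved = modified
      closed-mate
      (λ (d≡a , v∈) → d≡a , closed-transpose v∈)
      (λ _ → transpose-involutive x y _)
      (λ _ → adj-transpose)
      (λ (d≡a , _) (e≡a , _) _ _ → trans d≡a (sym e≡a))
      (λ {d} {e} _ _ eq ≢v → contradiction eq (not-mate {e} ≢v))

    mate-other : ∀ {d} v → d ≢ a → mate moved d v ≡ mate C d v
    mate-other v d≢a = outside (d≢a ∘ proj₁)

    mate-x : mate moved a x ≡ y
    mate-x = trans (inside (refl , inj₁ refl)) (transpose-matchˡ x y)

    mate-untouched : ∀ {v} → v ≢ x → v ≢ y → v ≢ z → mate moved a v ≡ mate C a v
    mate-untouched v≢x v≢y v≢z = outside ([ v≢x , [ v≢y , v≢z ]′ ]′ ∘ proj₂)

    -- Only the colour `a` changes, and only at `x`, `y` and `z`; no edge at `y` had it.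
    covers : ∀ {u v} → Adj G u v → Covered C u v →
             Covered moved u v ⊎ (u ≡ x × v ≡ z) ⊎ (v ≡ x × u ≡ z)
    covers {u} uv (d , refl) = cases (d ≟ a) (u ≟ x) (u ≟ y) (u ≟ z)
      where
      cases : Dec (d ≡ a) → Dec (u ≡ x) → Dec (u ≡ y) → Dec (u ≡ z) →
              Covered moved u (mate C d u) ⊎
              (u ≡ x × mate C d u ≡ z) ⊎ (mate C d u ≡ x × u ≡ z)
      cases (no d≢a)   _          _          _          = inj₁ (d , mate-other u d≢a)
      cases (yes refl) (yes refl) _          _          = inj₂ (inj₁ (refl , refl))
      cases (yes refl) _          (yes refl) _          = contradiction (sym y-misses-a) (Adj⇒≢ uv)
      cases (yes refl) _          _          (yes refl) = inj₂ (inj₂ (involutive C a x , refl))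
      cases (yes refl) (no u≢x)   (no u≢y)   (no u≢z)   = inj₁ (a , mate-untouched u≢x u≢y u≢z)

  -- The colour a l is to be moved from the edge x (y (suc l)) to the edge x (y l).
  record Fan (C : PartialColouring G k) (x : Fin n) (y : ℕ → Fin n) (a : ℕ → Fin k) (i : ℕ) : Set where
    field
      missing  : ∀ {l} → l < i → mate C (a l) (y l) ≡ y l
      next     : ∀ {l} → l < i → mate C (a l) x ≡ y (suc l)
      present  : ∀ {l} → l < i → mate C (a l) x ≢ x
      distinct : ∀ {l m} → l < m → m < i → a l ≢ a m

  open Fan

  -- By induction on the length: giving `a 0` to the edge `x (y 0)` moves the hole to `x (y 1)`, and
  -- the rest of the fan survives because its colours differ from `a 0`. At length 0 the colour `b`
  -- is missing at both ends of the hole.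
  shift : ∀ i (C : PartialColouring G k) {x} {y : ℕ → Fin n} {a : ℕ → Fin k} → Fan C x y a i →
          Adj G x (y 0) → ¬ Covered C x (y 0) →
          ∀ {b} → mate C b (y i) ≡ y i → mate C b x ≡ x → CanColour C x (y 0)
  shift zero C {x} fan xy uncovered {b} y-misses-b x-misses-b =
    moved , (λ uv uv∈C → keep uv (covers uv uv∈C)) , (b , mate-x)
    where
    open Move C b xy y-misses-b uncovered
    keep : ∀ {u v} → Adj G u v →
           Covered moved u v ⊎ (u ≡ x × v ≡ mate C b x) ⊎ (v ≡ x × u ≡ mate C b x) →
           Covered moved u v
    keep uv (inj₁ covered)             = covered
    keep uv (inj₂ (inj₁ (refl , v≡z))) = contradiction (sym (trans v≡z x-misses-b)) (Adj⇒≢ uv)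
    keep uv (inj₂ (inj₂ (refl , u≡z))) = contradiction (trans u≡z x-misses-b) (Adj⇒≢ uv)
  shift (suc i) C {x} {y} {a} fan xy uncovered {b} y-misses-b x-misses-b =
    C′ , (λ uv uv∈C → keep uv (covers uv uv∈C)) , extends xy (a 0 , mate-x)
    where
    open Move C (a 0) xy (missing fan z<s) uncovered

    x-y₁ : mate C (a 0) x ≡ y 1
    x-y₁ = next fan z<s

    x≢y₁ : mate C (a 0) x ≢ x
    x≢y₁ = present fan z<s

    later : ∀ {l} → l < i → a (suc l) ≢ a 0
    later l<i = ≢-sym (distinct fan z<s (s<s l<i))

    b≢a₀ : b ≢ a 0
    b≢a₀ refl = x≢y₁ x-misses-b

    fan′ : Fan moved x (y ∘ suc) (a ∘ suc) i
    fan′ .missing l<i     = trans (mate-other _ (later l<i)) (missing fan (s<s l<i))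
    fan′ .next l<i        = trans (mate-other _ (later l<i)) (next fan (s<s l<i))
    fan′ .present l<i     = present fan (s<s l<i) ∘ trans (sym (mate-other _ (later l<i)))
    fan′ .distinct l<m m<i = distinct fan (s<s l<m) (s<s m<i)

    -- Colour `a 0` now leads from `x` to `y 0`, so it would show `x (y 0)` covered before the move.
    -- Any other colour would have joined `x` to `y 1` already in `C`, next to `a 0`.
    uncovered′ : ¬ Covered moved x (y 1)
    uncovered′ (d , x-y₁-d) = case d ≟ a 0 of λ where
      (yes refl) → uncovered (a 0 , trans x-y₁ (trans (sym x-y₁-d) mate-x))
      (no d≢a₀)  → d≢a₀ (sym (disjoint C
        (trans x-y₁ (trans (sym x-y₁-d) (mate-other x d≢a₀))) x≢y₁))

    recursive : CanColour moved x (y 1)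
    recursive = shift i moved fan′
      (subst (Adj G x) x-y₁ (adjacent C (a 0) x x≢y₁)) uncovered′
      (trans (mate-other _ b≢a₀) y-misses-b) (trans (mate-other _ b≢a₀) x-misses-b)

    C′ = proj₁ recursive
    extends = proj₁ (proj₂ recursive)

    keep : ∀ {u v} → Adj G u v →
           Covered moved u v ⊎ (u ≡ x × v ≡ mate C (a 0) x) ⊎ (v ≡ x × u ≡ mate C (a 0) x) →
           Covered C′ u v
    keep uv (inj₁ covered)              = extends uv covered
    -- The edge that lost its colour is `x (y 1)`, the one coloured by the recursive call.
    keep uv (inj₂ (inj₁ (refl , refl))) = subst (Covered C′ x) (sym x-y₁) (proj₂ (proj₂ recursive))
    keep uv (inj₂ (inj₂ (refl , refl))) =
      covered-sym C′ (subst (Covered C′ x) (sym x-y₁) (proj₂ (proj₂ recursive)))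

  -- Swapping a and c outside the component of x, rather than inside it, leaves the
  -- colours at x unchanged, and with them the edges of a fan at x.
  module Kempe (C : PartialColouring G k) {a c : Fin k} {x : Fin n} (comp : Component (mate C c) (mate C a) x)
    where

    open Component comp

    private
      Q : Fin k → Fin n → Set
      Q d v = (d ≡ a ⊎ d ≡ c) × ¬ Member v

      Q? : ∀ d v → Dec (Q d v)
      Q? d v = (d ≟ a ⊎-dec d ≟ c) ×-dec ¬? (member? v)

      π : Fin k → Fin k
      π = transpose a c

      π-in : ∀ {d} → d ≡ a ⊎ d ≡ c → π d ≡ a ⊎ π d ≡ c
      π-in (inj₁ refl) = inj₂ (transpose-matchˡ a c)
      π-in (inj₂ refl) = inj₁ (transpose-matchʳ a c)

      π-fixes : ∀ {d} → ¬ (d ≡ a ⊎ d ≡ c) → π d ≡ d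
      π-fixes d∉ = transpose-mismatch a c (d∉ ∘ inj₁) (d∉ ∘ inj₂)

      π-injective : ∀ {d e} → π d ≡ π e → d ≡ e
      π-injective {d} {e} eq = trans (sym (transpose-involutive a c d))
        (trans (cong π eq) (transpose-involutive a c e))

      open Modify C Q? (mate C ∘ π)

      stays : ∀ {d v} → d ≡ a ⊎ d ≡ c → Member v → Member (mate C d v)
      stays (inj₁ refl) = closedʳ
      stays (inj₂ refl) = closedˡ

      stays-out : ∀ {d v} → d ≡ a ⊎ d ≡ c → ¬ Member v → ¬ Member (mate C d v)
      stays-out {d} {v} d∈ v∉ v′∈ = v∉ (subst Member (involutive C d v) (stays d∈ v′∈))

    swapped : PartialColouring G k
    swapped = modified
      (λ (d∈ , v∉) → d∈ , stays-out d∈ v∉)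
      (λ (d∈ , v∉) → d∈ , stays-out (π-in d∈) v∉)
      (λ {d} {v} _ → involutive C (π d) v)
      (λ {d} {v} _ → adjacent C (π d) v)
      (λ _ _ eq ≢v → π-injective (disjoint C eq ≢v))
      -- Outside the component an unswapped colour is neither `a` nor `c`, so `π` fixes it and
      -- injectivity of `π` applies again.
      (λ {d} {e} (_ , v∉) ¬q eq ≢v →
        let πe≡e = π-fixes (λ e∈ → ¬q (e∈ , v∉)) in
        π-injective (trans (disjoint C eq ≢v) (sym πe≡e)))

    swapped-other : ∀ {d} v → d ≢ a → d ≢ c → mate swapped d v ≡ mate C d v
    swapped-other v d≢a d≢c = outside ([ d≢a , d≢c ]′ ∘ proj₁)

    swapped-member : ∀ {d v} → Member v → mate swapped d v ≡ mate C d v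
    swapped-member v∈ = outside (λ (_ , v∉) → v∉ v∈)

    swapped-c : ∀ {v} → ¬ Member v → mate swapped c v ≡ mate C a v
    swapped-c {v} v∉ = trans (inside (inj₂ refl , v∉)) (cong (λ d → mate C d v) (transpose-matchʳ a c))

    swapped-covers : ∀ {u v} → Covered C u v → Covered swapped u v
    swapped-covers {u} (d , refl) = case Q? d u of λ where
      (yes (d∈ , u∉)) → π d , trans (inside (π-in d∈ , u∉))
                                (cong (λ e → mate C e u) (transpose-involutive a c d))
      (no ¬q) → d , outside ¬q

  canColour-extends : {C C′ : PartialColouring G k} {x y : Fin n} →
                      Extends C C′ → CanColour C′ x y → CanColour C x y
  canColour-extends ext (C″ , ext′ , covered) = C″ , (λ uv → ext′ uv ∘ ext uv) , covered

  -- The component of x has only one other end, hence does not contain both y j and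
  -- y i.  Swapping outside it makes c missing at one of them, and the fan up to that
  -- vertex survives.
  recolour : ∀ (C : PartialColouring G k) {x y a i j c} → Fan C x y a i →
             Adj G x (y 0) → ¬ Covered C x (y 0) →
             mate C c x ≡ x → mate C (a i) x ≢ x → mate C (a i) (y i) ≡ y i →
             j < i → a j ≡ a i → CanColour C x (y 0)
  recolour {k} C {x} {y} {a} {i} {j} {c} fan xy uncovered x-misses-c x-has-aᵢ yᵢ-misses-aᵢ j<i aⱼ≡aᵢ =
    canColour-extends {C = C} {swapped} (λ _ → swapped-covers) (finish (member? (y j)))
    where
    comp : Component (mate C c) (mate C (a i)) x
    comp = component (involutive C c) (involutive C (a i)) x-misses-c

    open Component comp
    open Kempe C comp

    aₗ≢c : ∀ {l} → l < i → a l ≢ c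
    aₗ≢c l<i refl = present fan l<i x-misses-c

    -- The colours before index `i` are distinct, so `a i` occurs among them only at `j`.
    aₗ≢aᵢ : ∀ {l} → l < i → l ≢ j → a l ≢ a i
    aₗ≢aᵢ {l} l<i l≢j aₗ≡aᵢ with ℕ.<-cmp l j
    ... | tri< l<j _ _ = distinct fan l<j j<i (trans aₗ≡aᵢ (sym aⱼ≡aᵢ))
    ... | tri≈ _ l≡j _ = l≢j l≡j
    ... | tri> _ _ j<l = distinct fan j<l l<i (trans aⱼ≡aᵢ (sym aₗ≡aᵢ))

    yⱼ-misses-aᵢ : mate C (a i) (y j) ≡ y j
    yⱼ-misses-aᵢ = subst (λ d → mate C d (y j) ≡ y j) aⱼ≡aᵢ (missing fan j<i)

    same-x : ∀ d → mate swapped d x ≡ mate C d x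
    same-x _ = swapped-member base

    uncovered′ : ¬ Covered swapped x (y 0)
    uncovered′ (d , eq) = uncovered (d , trans (sym (same-x d)) eq)

    same-missing : ∀ {l} → l < i → l ≢ j → mate swapped (a l) (y l) ≡ y l
    same-missing l<i l≢j = trans (swapped-other _ (aₗ≢aᵢ l<i l≢j) (aₗ≢c l<i)) (missing fan l<i)

    -- Of the colours of the fan only `a j` takes part in the swap, `c` being missing at `x`. So
    -- only `missing` at `j` is at stake, and it survives if `y j` lies in the component.
    fan-to : ∀ m → m ≤ i → (∀ {l} → l < m → l ≡ j → Member (y j)) → Fan swapped x y a m
    fan-to m m≤i yⱼ∈ .missing {l} l<m = case l ℕ.≟ j of λ where
      (yes refl) → trans (swapped-member (yⱼ∈ l<m refl)) (missing fan (ℕ.<-≤-trans l<m m≤i))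
      (no l≢j)   → same-missing (ℕ.<-≤-trans l<m m≤i) l≢j
    fan-to m m≤i _ .next l<m          = trans (same-x _) (next fan (ℕ.<-≤-trans l<m m≤i))
    fan-to m m≤i _ .present l<m       = present fan (ℕ.<-≤-trans l<m m≤i) ∘ trans (sym (same-x _))
    fan-to m m≤i _ .distinct l<l′ l′<m = distinct fan l<l′ (ℕ.<-≤-trans l′<m m≤i)

    y≢x : ∀ {l} → l ≤ i → y l ≢ x
    y≢x {zero}  _   = ≢-sym (Adj⇒≢ xy)
    y≢x {suc l} l<i = present fan l<i ∘ trans (next fan l<i)

    -- y l ≡ y m forces a (l ∸ 1) ≡ a (m ∸ 1), or an edge x (y 0) that is coloured already.
    y-distinct : ∀ {l m} → l < m → m ≤ i → y l ≢ y m
    y-distinct {zero}  {suc m} _         m<i eq = uncovered (a m , trans (next fan m<i) (sym eq))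
    y-distinct {suc l} {suc m} (s≤s l<m) m<i eq =
      distinct fan l<m m<i (disjoint C
        (trans (next fan l<i) (trans eq (sym (next fan m<i)))) (present fan l<i))
      where
      l<i : l < i
      l<i = ℕ.<-trans l<m m<i

    finish : Dec (Member (y j)) → CanColour swapped x (y 0)
    finish (no yⱼ∉) = shift j swapped
      (fan-to j (ℕ.<⇒≤ j<i) (λ l<j l≡j → contradiction l≡j (ℕ.<⇒≢ l<j)))
      xy uncovered′ (trans (swapped-c yⱼ∉) yⱼ-misses-aᵢ) (trans (same-x c) x-misses-c)
    finish (yes yⱼ∈) = shift i swapped (fan-to i ℕ.≤-refl (λ _ _ → yⱼ∈))
      xy uncovered′ (trans (swapped-c yᵢ∉) yᵢ-misses-aᵢ) (trans (same-x c) x-misses-c)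
      where
      yᵢ∉ : ¬ Member (y i)
      yᵢ∉ yᵢ∈ = y-distinct j<i ℕ.≤-refl
        (otherEnd yⱼ∈ yᵢ∈ (y≢x (ℕ.<⇒≤ j<i)) (y≢x ℕ.≤-refl) (inj₂ yⱼ-misses-aᵢ) (inj₂ yᵢ-misses-aᵢ))

  -- If all colours were present at `v`, they would lead to `k` different neighbours.
  missingColour : (∀ v → degree G v < k) → (C : PartialColouring G k) →
                  ∀ v → ∃[ a ] mate C a v ≡ v
  missingColour {k} deg<k C v with any? (λ a → mate C a v ≟ v)
  ... | yes found = found
  ... | no all-present = contradiction (deg<k v)
    (ℕ.≤⇒≯ (subst (_≤ degree G v) (length-tabulate id)
      (length-≤-of-injective-relation {R = λ a w → mate C a v ≡ w} (allFin⁺ k)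
        (λ {a} _ → lose (∈-filter⁺ (Adj? G v) (∈-allFin (mate C a v))
          (adjacent C a v (λ eq → all-present (a , eq)))) refl)
        (λ {a} _ _ eq eq′ → disjoint C (trans eq (sym eq′)) (λ eq → all-present (a , eq))))))

  module _ (deg<k : ∀ v → degree G v < k) where

    colourEdge : (C : PartialColouring G k) → ∀ {x y} → Adj G x y → CanColour C x y
    colourEdge C {x} {y₀} xy with any? (λ d → mate C d x ≟ y₀)
    ... | yes covered = C , (λ _ → id) , covered
    ... | no uncovered = conclude (grow (suc k))
      where
      miss : Fin n → Fin k
      miss v = proj₁ (missingColour deg<k C v)

      misses : ∀ v → mate C (miss v) v ≡ v
      misses v = proj₂ (missingColour deg<k C v)

      -- Defined for all indices, but a fan only until the chosen colour is missing at `x` as well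
      -- or repeats an earlier one; `grow` acts on whichever happens first.
      y : ℕ → Fin n
      y zero    = y₀
      y (suc l) = mate C (miss (y l)) x

      a : ℕ → Fin k
      a = miss ∘ y

      grow : ∀ i → CanColour C x y₀ ⊎ Fan C x y a i
      grow zero    = inj₂ record
        { missing = λ () ; next = λ () ; present = λ () ; distinct = λ _ () }
      grow (suc i) with grow i
      ... | inj₁ done = inj₁ done
      ... | inj₂ fan with mate C (a i) x ≟ x
      ...   | yes x-misses-aᵢ = inj₁ (shift i C fan xy uncovered (misses (y i)) x-misses-aᵢ)
      ...   | no x-has-aᵢ with any? (λ (j : Fin i) → a (toℕ j) ≟ a i)
      ...     | yes (j , eq) = inj₁
        (recolour C fan xy uncovered (misses x) x-has-aᵢ (misses (y i)) (toℕ<n j) eq)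
      ...     | no new = inj₂ record
        { missing  = λ {l} _ → misses (y l)
        ; next     = λ _ → refl
        ; present  = λ l<1+i → [ present fan , (λ { refl → x-has-aᵢ }) ]′ (ℕ.m≤n⇒m<n∨m≡n (s≤s⁻¹ l<1+i))
        ; distinct = λ {l} {m} l<m m<1+i →
            [ distinct fan l<m
            , (λ { refl eq → new (fromℕ< l<m , trans (cong a (toℕ-fromℕ< l<m)) eq) })
            ]′ (ℕ.m≤n⇒m<n∨m≡n (s≤s⁻¹ m<1+i))
        }

      -- A fan of length `suc k` would have more distinct colours than there are.
      conclude : CanColour C x y₀ ⊎ Fan C x y a (suc k) → CanColour C x y₀
      conclude (inj₁ done) = done
      conclude (inj₂ fan) with i , j , i<j , eq ← pigeonhole (ℕ.n<1+n k) (a ∘ toℕ) =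
        contradiction eq (distinct fan i<j (toℕ<n j))

    colourEdges : (es : List (Fin n × Fin n)) →
      Σ[ C ∈ PartialColouring G k ] All (λ (u , v) → Adj G u v → Covered C u v) es
    colourEdges [] = record
      { mate       = λ _ v → v
      ; involutive = λ _ _ → refl
      ; adjacent   = λ _ _ ≢v → contradiction refl ≢v
      ; disjoint   = λ _ ≢v → contradiction refl ≢v
      } , []
    colourEdges ((u , v) ∷ es) with C , cov ← colourEdges es | Adj? G u v
    ... | no ¬uv = C , (λ uv → contradiction uv ¬uv) ∷ cov
    ... | yes uv with C′ , ext , uv∈C′ ← colourEdge C uv =
      C′ , (λ _ → uv∈C′) ∷ All.map (λ covered e → ext e (covered e)) cov

    vizing : EdgeColouring G k
    vizing = record
      { colour     = λ e → proj₁ (covered e)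
      ; undirected = λ e e′ → colours-agree e (proj₂ (covered e)) (proj₂ (covered e′))
      ; proper     = λ e e′ v≢w eq → v≢w
          (trans (sym (proj₂ (covered e))) (trans (cong (λ d → mate C d _) eq) (proj₂ (covered e′))))
      }
      where
      pairs : List (Fin n × Fin n)
      pairs = cartesianProduct (allFin n) (allFin n)

      C : PartialColouring G k
      C = proj₁ (colourEdges pairs)

      covered : ∀ {u v} → Adj G u v → Covered C u v
      covered {u} {v} = All.lookup (proj₂ (colourEdges pairs))
        (∈-cartesianProduct⁺ (∈-allFin u) (∈-allFin v))

      -- Since only one colour joins the two ends, the colour found depends neither on the
      -- orientation nor on the proof of adjacency.
      colours-agree : ∀ {d e u v} → Adj G u v → mate C d u ≡ v → mate C e v ≡ u → d ≡ e
      colours-agree uv refl e-vu = disjoint C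
        (trans (sym (involutive C _ _)) (cong (mate C _) e-vu)) (≢-sym (Adj⇒≢ uv))

  -- Edge colourings and embeddings of the complement

  degree≤Δ : ∀ v → degree G v ≤ Δ G
  degree≤Δ v = v≤max⁺ 0 _ (inj₂ (lose (∈-map⁺ (degree G) (∈-allFin v)) ℕ.≤-refl))

  Δ-lub : ∀ {m} → (∀ v → degree G v ≤ m) → Δ G ≤ m
  Δ-lub degree≤m = max≤v⁺ z≤n (All.map⁺ (All.tabulate⁺ degree≤m))

  ∈-neighbours⁺ : ∀ {v w} → Adj G v w → w ∈ filter (Adj? G v) (allFin n)
  ∈-neighbours⁺ {v} {w} = ∈-filter⁺ (Adj? G v) (∈-allFin w)

  ∈-neighbours⁻ : ∀ {v w} → w ∈ filter (Adj? G v) (allFin n) → Adj G v w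
  ∈-neighbours⁻ {v} w∈ = proj₂ (∈-filter⁻ (Adj? G v) {xs = allFin n} w∈)

  neighbours-unique : ∀ v → Unique (filter (Adj? G v) (allFin n))
  neighbours-unique v = filter⁺ (Adj? G v) (allFin⁺ n)

  Δ≤colours : EdgeColouring G k → Δ G ≤ k
  Δ≤colours {k} χ = Δ-lub λ v → subst (degree G v ≤_) (length-tabulate id)
    (length-≤-of-injective-relation
      {R = λ w a → Σ[ e ∈ Adj G v w ] colour e ≡ a}
      (neighbours-unique v)
      (λ w∈ → lose (∈-allFin _) (∈-neighbours⁻ w∈ , refl))
      (λ {w} {w′} _ _ (e , eq) (e′ , eq′) → decidable-stable (w ≟ w′)
        (λ w≢w′ → proper e e′ w≢w′ (trans eq (sym eq′)))))
    where open EdgeColouring χ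

  module Matching (χ : EdgeColouring G k) where

    open EdgeColouring χ

    Joined : Fin k → Fin n → Fin n → Set
    Joined d v w = Σ[ e ∈ Adj G v w ] colour e ≡ d

    colour-irrelevant : ∀ {u v} (e e′ : Adj G u v) → colour e ≡ colour e′
    colour-irrelevant e e′ = trans (undirected e (Graph.sym G e)) (undirected (Graph.sym G e) e′)

    joined-sym : ∀ {d v w} → Joined d v w → Joined d w v
    joined-sym (e , eq) = Graph.sym G e , trans (undirected (Graph.sym G e) e) eq

    joined? : ∀ d v w → Dec (Joined d v w)
    joined? d v w with Adj? G v w
    ... | no ¬e = no (¬e ∘ proj₁)
    ... | yes e = map′ (e ,_) (λ (e′ , eq) → trans (colour-irrelevant e e′) eq) (colour e ≟ d)

    joined-unique : ∀ {d v w w′} → Joined d v w → Joined d v w′ → w ≡ w′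
    joined-unique {w = w} {w′} (e , eq) (e′ , eq′) = decidable-stable (w ≟ w′)
      (λ w≢w′ → proper e e′ w≢w′ (trans eq (sym eq′)))

    partner : Fin k → Fin n → Fin n
    partner d v with any? (joined? d v)
    ... | yes (w , _) = w
    ... | no _        = v

    joined⇒partner : ∀ {d v w} → Joined d v w → partner d v ≡ w
    joined⇒partner {d} {v} j with any? (joined? d v)
    ... | yes (_ , j′) = joined-unique j′ j
    ... | no none      = contradiction (_ , j) none

    partner-cases : ∀ d v → partner d v ≡ v ⊎ Joined d v (partner d v)
    partner-cases d v with any? (joined? d v)
    ... | yes (_ , j) = inj₂ j
    ... | no _        = inj₁ refl

    module Min = Algebra.Construct.NaturalChoice.Min (Fin.≤-totalOrder n)
    open Min using (_⊓_; ⊓-sel; ⊓-comm)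

    -- The edges of colour `d` and the vertices they miss partition the vertex set; each part is
    -- named by its smallest vertex.
    class : Fin n → Fin k → Fin n
    class v d = v ⊓ partner d v

    class-joined : ∀ {d u v} → Joined d u v → class u d ≡ class v d
    class-joined {d} {u} {v} j
      rewrite joined⇒partner j | joined⇒partner (joined-sym j) = ⊓-comm u v

    class-member : ∀ v d → class v d ≡ v ⊎ Joined d v (class v d)
    class-member v d with ⊓-sel v (partner d v) | partner-cases d v
    ... | inj₁ eq | _        = inj₁ eq
    ... | inj₂ eq | inj₁ eq′ = inj₁ (trans eq eq′)
    ... | inj₂ eq | inj₂ j   = inj₂ (subst (Joined d v) (sym eq) j)

    -- The name of a part belongs to it, and a part is a single vertex or an edge. If neither vertex
    -- is the name, both are joined to it by colour `d` and so coincide.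
    class-injective : ∀ {d u v} → class u d ≡ class v d → u ≡ v ⊎ Joined d u v
    class-injective {d} {u} {v} eq with class-member u d | class-member v d
    ... | inj₁ cu | inj₁ cv = inj₁ (trans (sym cu) (trans eq cv))
    ... | inj₁ cu | inj₂ j  = inj₂ (joined-sym (subst (Joined d v) (trans (sym eq) cu) j))
    ... | inj₂ j  | inj₁ cv = inj₂ (subst (Joined d u) (trans eq cv) j)
    ... | inj₂ j  | inj₂ j′ =
      inj₁ (joined-unique (joined-sym j) (subst (λ w → Joined d w v) (sym eq) (joined-sym j′)))

  -- Two colours are needed: with a single one, the ends of an edge would be
  -- mapped to the same vertex.
  colouring⇒embedding : 2 ≤ k → EdgeColouring G k → EmbedsInCompleteProduct (complement G) k
  colouring⇒embedding (s≤s (s≤s _)) χ = (λ _ → n) , class , record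
    { isOrderHomomorphism = record
      { cong = λ { refl _ → refl }
      ; mono = λ (u≢v , ¬uv) d eq → [ u≢v , ¬uv ∘ proj₁ ]′ (class-injective eq)
      }
    ; injective = λ eq → distinguish (class-injective (eq zero)) (class-injective (eq (suc zero)))
    ; cancel = λ apart →
        (λ { refl → apart zero refl }) , (λ uv → apart (colour uv) (class-joined (uv , refl)))
    }
    where
    open EdgeColouring χ
    open Matching χ
    -- Distinct vertices cannot share both parts, as their edge would have two colours.
    distinguish : ∀ {u v} → u ≡ v ⊎ Joined zero u v → u ≡ v ⊎ Joined (suc zero) u v → u ≡ v
    distinguish (inj₁ eq) _ = eq
    distinguish _ (inj₁ eq) = eq
    distinguish (inj₂ (e , eq)) (inj₂ (e′ , eq′))
      with () ← trans (sym eq) (trans (colour-irrelevant e e′) eq′)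

-- Triangle-free graphs: colourings from embeddings, and the lower bound for clique covers

Smallest : (Fin k → Set) → Fin k → Set
Smallest P i = ¬ P i × (∀ (j : Fin.Fin′ i) → P (Fin.inject j))

smallest-minimal : {P : Fin k → Set} {i j : Fin k} → Smallest P i → j Fin.< i → P j
smallest-minimal {P = P} (_ , below) j<i = subst P
  (Fin.toℕ-injective (trans (Fin.toℕ-inject (fromℕ< j<i)) (toℕ-fromℕ< j<i)))
  (below (fromℕ< j<i))

-- This makes the colour of an edge, chosen as a least index, the same from both ends.
smallest-unique : {P Q : Fin k → Set} → (∀ {i} → P i → Q i) → (∀ {i} → Q i → P i) →
                  ∀ {i j} → Smallest P i → Smallest Q j → i ≡ j
smallest-unique P⇒Q Q⇒P {i} {j} s t with Fin.<-cmp i j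
... | tri< i<j _ _ = contradiction (Q⇒P (smallest-minimal t i<j)) (proj₁ s)
... | tri≈ _ i≡j _ = i≡j
... | tri> _ _ j<i = contradiction (P⇒Q (smallest-minimal s j<i)) (proj₁ t)

module _ {G : Graph n} (triangleFree : TriangleFree G) where

  -- Adjacent vertices agree in some coordinate, and the least such is the colour. If edges `u v`
  -- and `u w` had the same colour, `v` and `w` would agree there too; but without triangles they
  -- are adjacent in the complement, and so differ everywhere.
  embedding⇒colouring : EmbedsInCompleteProduct (complement G) k → EdgeColouring G k
  embedding⇒colouring {k} (m , f , mono) = record
    { colour     = λ e → proj₁ (shared e)
    ; undirected = λ e e′ →
        smallest-unique {P = Apart _ _} {Q = Apart _ _} apart-sym apart-sym
          (proj₂ (shared e)) (proj₂ (shared e′))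
    ; proper     = λ {u} {v} {w} e e′ v≢w eq →
        nonadjacent⇒apart v≢w (triangleFree (Graph.sym G e) e′) (proj₁ (shared e))
          (trans (sym (agree e)) (subst (λ i → f u i ≡ f w i) (sym eq) (agree e′)))
    }
    where
    Apart : Fin n → Fin n → Fin k → Set
    Apart u v i = f u i ≢ f v i

    apart-sym : ∀ {u v i} → Apart u v i → Apart v u i
    apart-sym = ≢-sym

    shared : ∀ {u v} → Adj G u v → ∃ (Smallest (Apart u v))
    shared {u} {v} e = Fin.¬∀⟶∃¬-smallest k (Apart u v) (λ i → ¬? (f u i ≟ f v i))
      (λ apart → proj₂ (IsOrderMonomorphism.cancel mono apart) e)

    agree : ∀ {u v} (e : Adj G u v) → f u (proj₁ (shared e)) ≡ f v (proj₁ (shared e))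
    agree {u} {v} e = decidable-stable (f u _ ≟ f v _) (proj₁ (proj₂ (shared e)))

    nonadjacent⇒apart : ∀ {v w} → v ≢ w → ¬ Adj G v w → ∀ i → f v i ≢ f w i
    nonadjacent⇒apart v≢w ¬vw = IsOrderMonomorphism.mono mono (v≢w , ¬vw)

  -- A clique containing `v` and two of its neighbours would contain a triangle, so different
  -- neighbours need different cliques at `v`.
  cover⇒Δ≤ : HasCliqueCover G k → Δ G ≤ k
  cover⇒Δ≤ (Cs , cover) = Δ-lub {G = G} λ v → ℕ.≤-trans
    (length-≤-of-injective-relation {R = λ w C → v ∈ˢ C × w ∈ˢ C × IsClique G C}
      (neighbours-unique {G = G} v)
      (λ w∈ → witness v (covers (∈-neighbours⁻ {G = G} w∈)))
      (λ {w} {w′} w∈ w′∈ (v∈C , w∈C , clique) (_ , w′∈C , _) → decidable-stable (w ≟ w′) λ w≢w′ →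
        triangleFree (∈-neighbours⁻ {G = G} w∈) (clique w∈C w′∈C w≢w′) (∈-neighbours⁻ {G = G} w′∈)))
    (bounded v)
    where
    open IsCliqueCover cover
    witness : ∀ v {w} → Any (λ C → v ∈ˢ C × w ∈ˢ C) Cs →
              Any (λ C → v ∈ˢ C × w ∈ˢ C × IsClique G C) (filter (v ∈ˢ?_) Cs)
    witness v both with C , C∈ , v∈C , w∈C ← find both =
      lose (∈-filter⁺ (v ∈ˢ?_) C∈ v∈C) (v∈C , w∈C , All.lookup cliques C∈)

-- The clique cover by the edges

length-filter-map : {A B : Set} {P : B → Set} (P? : Decidable P) (f : A → B) (xs : List A) →
                    length (filter P? (map f xs)) ≡ length (filter (P? ∘ f) xs)
length-filter-map P? f [] = refl
length-filter-map P? f (x ∷ xs) with does (P? (f x))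
... | true  = cong suc (length-filter-map P? f xs)
... | false = length-filter-map P? f xs

module _ (G : Graph n) where

  private
    -- The order picks one orientation, so that no edge enters the cover twice.
    Edge : Fin n × Fin n → Set
    Edge (u , v) = u Fin.< v × Adj G u v

    edge? : Decidable Edge
    edge? (u , v) = u Fin.<? v ×-dec Adj? G u v

    edges : List (Fin n × Fin n)
    edges = filter edge? (cartesianProduct (allFin n) (allFin n))

    edges-unique : Unique edges
    edges-unique = filter⁺ edge? (cartesianProduct⁺ (allFin⁺ n) (allFin⁺ n))

    ∈-edges : ∀ {u v} → Edge (u , v) → (u , v) ∈ edges
    ∈-edges e = ∈-filter⁺ edge? (∈-cartesianProduct⁺ (∈-allFin _) (∈-allFin _)) e

    edges-sound : ∀ {e} → e ∈ edges → Edge e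
    edges-sound = proj₂ ∘ ∈-filter⁻ edge? {xs = cartesianProduct (allFin n) (allFin n)}

    ends : Fin n × Fin n → Subset n
    ends (u , v) = ⁅ u ⁆ ∪ ⁅ v ⁆

    ∈-ends⁻ : ∀ {w} u v → w ∈ˢ ends (u , v) → w ≡ u ⊎ w ≡ v
    ∈-ends⁻ u v = Sum.map (x∈⁅y⁆⇒x≡y u) (x∈⁅y⁆⇒x≡y v) ∘ x∈p∪q⁻ ⁅ u ⁆ ⁅ v ⁆

    first∈ : ∀ u v → u ∈ˢ ends (u , v)
    first∈ u v = x∈p∪q⁺ (inj₁ (x∈⁅x⁆ u))

    second∈ : ∀ u v → v ∈ˢ ends (u , v)
    second∈ u v = x∈p∪q⁺ (inj₂ (x∈⁅x⁆ v))

    ends-clique : ∀ {e} → Edge e → IsClique G (ends e)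
    ends-clique {a , b} (_ , ab) u∈ v∈ u≢v with ∈-ends⁻ a b u∈ | ∈-ends⁻ a b v∈
    ... | inj₁ refl | inj₁ refl = contradiction refl u≢v
    ... | inj₁ refl | inj₂ refl = ab
    ... | inj₂ refl | inj₁ refl = Graph.sym G ab
    ... | inj₂ refl | inj₂ refl = contradiction refl u≢v

    EndsAre : Fin n → Fin n × Fin n → Fin n → Set
    EndsAre v (a , b) w = (v ≡ a × w ≡ b) ⊎ (v ≡ b × w ≡ a)

    endsAre-injective : ∀ {v e e′ w} → Edge e → Edge e′ →
                        EndsAre v e w → EndsAre v e′ w → e ≡ e′
    endsAre-injective _ _ (inj₁ (refl , refl)) (inj₁ (refl , refl)) = refl
    endsAre-injective (a<b , _) (b<a , _) (inj₁ (refl , refl)) (inj₂ (refl , refl)) =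
      contradiction b<a (ℕ.<-asym a<b)
    endsAre-injective (a<b , _) (b<a , _) (inj₂ (refl , refl)) (inj₁ (refl , refl)) =
      contradiction b<a (ℕ.<-asym a<b)
    endsAre-injective _ _ (inj₂ (refl , refl)) (inj₂ (refl , refl)) = refl

    otherEnd : ∀ {v e} → Edge e → v ∈ˢ ends e →
               Any (EndsAre v e) (filter (Adj? G v) (allFin n))
    otherEnd {v} {a , b} (_ , ab) v∈ with ∈-ends⁻ a b v∈
    ... | inj₁ refl = lose (∈-neighbours⁺ {G = G} ab) (inj₁ (refl , refl))
    ... | inj₂ refl = lose (∈-neighbours⁺ {G = G} (Graph.sym G ab)) (inj₂ (refl , refl))

  -- The cliques at `v` are the edges at `v`, which are told apart by their other ends, neighbours
  -- of `v`.
  edgeCover : HasCliqueCover G (Δ G)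
  edgeCover = map ends edges , record
    { cliques = All.map⁺ (All.tabulate (ends-clique ∘ edges-sound))
    ; covers  = λ {u} {v} uv → Any.map⁺ (cover (Fin.<-cmp u v) uv)
    ; bounded = λ v → ℕ.≤-trans (ℕ.≤-reflexive (length-filter-map (v ∈ˢ?_) ends edges))
        (ℕ.≤-trans
          (length-≤-of-injective-relation {R = EndsAre v}
            (filter⁺ ((v ∈ˢ?_) ∘ ends) edges-unique)
            (λ e∈ → let e∈edges , v∈ = at v e∈ in otherEnd (edges-sound e∈edges) v∈)
            (λ e∈ e′∈ → endsAre-injective (edges-sound (proj₁ (at v e∈))) (edges-sound (proj₁ (at v e′∈)))))
          (degree≤Δ {G = G} v))
    }
    where
    at : ∀ v {e} → e ∈ filter ((v ∈ˢ?_) ∘ ends) edges → e ∈ edges × v ∈ˢ ends e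
    at v = ∈-filter⁻ ((v ∈ˢ?_) ∘ ends) {xs = edges}

    cover : ∀ {u v} → Tri (u Fin.< v) (u ≡ v) (v Fin.< u) → Adj G u v →
            Any (λ e → u ∈ˢ ends e × v ∈ˢ ends e) edges
    cover {u} {v} (tri< u<v _ _) uv = lose (∈-edges (u<v , uv)) (first∈ u v , second∈ u v)
    cover {u} {v} (tri≈ _ u≡v _) uv = contradiction uv (Graph.irrefl G u≡v)
    cover {u} {v} (tri> _ _ v<u) uv = lose (∈-edges (v<u , Graph.sym G uv)) (second∈ v u , first∈ v u)

-- The bound on `Δ G` excludes degenerate cases: a single edge is of class 1 and has rank dimension
-- 1, but its complement, two isolated vertices, has Prague dimension 2.
proposition6 : ∀ {n : ℕ} (G : Graph n) → 2 ≤ Δ G → TriangleFree G → IsFractal G ⇔ Class2 G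
proposition6 G 2≤Δ triangleFree = mk⇔ fractal⇒class2 class2⇒fractal
  where
  fractal⇒class2 : IsFractal G → Class2 G
  fractal⇒class2 (_ , _ , (r , (cover , _) , refl) , (p , (_ , p-least) , refl) , l<h) =
    vizing {G = G} (λ v → subst (degree G v <_) (ℕ.+-comm 1 (Δ G)) (s≤s (degree≤Δ {G = G} v))) ,
    -- With `r` the rank dimension and `p` the Prague dimension, `Δ G ≤ r < p`; and `p ≤ j`, since
    -- `j ≥ Δ G ≥ 2` lets the colouring yield an embedding.
    λ j χ → subst (_≤ j) (ℕ.+-comm 1 (Δ G)) (ℕ.<-≤-trans Δ<p
      (p-least j (colouring⇒embedding (ℕ.≤-trans 2≤Δ (Δ≤colours χ)) χ)))
    where
    Δ<p : Δ G < p
    Δ<p = ℕ.≤-<-trans (cover⇒Δ≤ triangleFree cover)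
      (ℤ.drop‿+<+ (subst₂ ℤ._<_ (ℤ-cancel r) (ℤ-cancel p) (ℤ.+-monoˡ-< ℤ.1ℤ l<h)))
      where
      ℤ-cancel : ∀ i → (ℤ.+ i ℤ.- ℤ.1ℤ) ℤ.+ ℤ.1ℤ ≡ ℤ.+ i
      ℤ-cancel i = trans (ℤ.+-assoc (ℤ.+ i) (ℤ.- ℤ.1ℤ) ℤ.1ℤ) (ℤ.+-identityʳ (ℤ.+ i))

  class2⇒fractal : Class2 G → IsFractal G
  class2⇒fractal (χ , χ-least) =
    _ , _ ,
    -- The dimensions before subtracting one are `Δ G` and the chromatic index `Δ G + 1`.
    (Δ G , (edgeCover G , λ _ → cover⇒Δ≤ triangleFree) , refl) ,
    (Δ G ℕ.+ 1 ,
      (colouring⇒embedding (ℕ.≤-trans 2≤Δ (ℕ.m≤m+n (Δ G) 1)) χ ,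
       λ j → χ-least j ∘ embedding⇒colouring triangleFree) ,
      refl) ,
    ℤ.+-monoˡ-< (ℤ.- ℤ.1ℤ) (ℤ.+<+ (ℕ.≤-reflexive (ℕ.+-comm 1 (Δ G))))
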